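{- Let $G=(V,E,I,\varsigma,\omega,\sigma)$ be an oriented hypergraph, and let $N$ be a non-edge-monic tail-equivalence class, or a non-edge-monic head-equivalence class, of contributors of $G$. Then $$\sum_{c\in N}\operatorname{csgn}(c)=0 .$$
   Context: An oriented hypergraph is a sextuple $G=(V,E,I,\varsigma,\omega,\sigma)$ with finite sets $V$ (vertices), $E$ (edges), $I$ (incidences) and functions $\varsigma:I\to V$ (port), $\omega:I\to E$ (attachment), $\sigma:I\to\{+1,-1\}$ (incidence signs). Several incidences may have the same port and attachment. A contributor $c$ of $G$ assigns to every $v\in V$ a step $(v,i_v,e_v,j_v,\pi(v))$, where $i_v,j_v\in I$ (possibly equal), $\omega(i_v)=\omega(j_v)=e_v\in E$, $\varsigma(i_v)=v$, $\varsigma(j_v)=\pi(v)$, such that $\pi=\pi_c:V\to V$ is a permutation. (Equivalently, $c$ is an incidence-preserving map $\bigsqcup_{v\in V}\overrightarrow{P}_1\to G$ of directed paths of length one with tails $t_v$ and heads $h_v$ such that $c(t_v)=v$ and $\{c(h_v)\mid v\in V\}=V$.) The incidence $i_v$ is the tail-incidence and $j_v$ the head-incidence of the step. The step at $v$ is a backstep if $i_v=j_v$; otherwise it is an adjacency (a loop if moreover $\pi(v)=v$). Contributor sign: $\operatorname{csgn}(c)=(-1)^{ec(c)+nc(c)+bs(c)}$, where $ec(c)$ is the number of cycles of even length of the permutation $\pi_c$; $bs(c)$ is the number of backsteps of $c$; and $nc(c)$ is the number of negative components, where a component is a cycle of $\pi_c$ whose steps are not a backstep (loops are included as components of length 1),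 and a component consisting of the steps at $v_1,\dots,v_k$ is negative if $(-1)^k\prod_{l=1}^{k}\sigma(i_{v_l})\sigma(j_{v_l})=-1$. Backsteps are not counted in $nc$. Two contributors are tail-equivalent if the images of their tail-incidences are the same, i.e. the sets $\{i_v\mid v\in V\}$ coincide (equivalently, they have the same $i_v$ for every $v$). They are head-equivalent if the images of their head-incidences are the same, i.e. the sets $\{j_v\mid v\in V\}$ coincide (equivalently, at each vertex $w$ the head-incidence with port $w$ is the same). A contributor is edge-monic if $e_v\ne e_w$ for all distinct $v,w\in V$. A tail-equivalence (head-equivalence) class is edge-monic if every contributor in it is edge-monic, and non-edge-monic otherwise. -}

module Defs where

open import Data.Fin.Base using (Fin; toℕ)
open import Data.Fin.Properties using (_≟_; all?; any?)
open import Data.Fin.Subset using (Subset; ⁅_⁆; ⋃; ∣_∣; _∈_)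
open import Data.Fin.Subset.Properties using (_∈?_)
open import Data.Integer.Base using (ℤ; 0ℤ; 1ℤ; -1ℤ; _◃_; _+_; _*_; _^_)
import Data.Integer.Properties as ℤ
open import Data.List.Base
  using (List; []; _∷_; length; filter; foldr; map; allFin; deduplicate;
         cartesianProduct; cartesianProductWith)
open import Data.List.Membership.Propositional renaming (_∈_ to _∈ₗ_)
open import Data.List.Membership.Propositional.Properties
  using (∈-allFin; ∈-cartesianProduct⁺; ∈-cartesianProductWith⁺)
open import Data.List.Relation.Unary.All as All using (All; []; _∷_)
open import Data.List.Relation.Unary.AllPairs using ([]; _∷_)
open import Data.List.Relation.Unary.Any using (here; there)
open import Data.List.Relation.Unary.Unique.Propositional using (Unique)
import Data.List.Relation.Unary.Unique.Propositional.Properties as Unique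
import Data.Bool.Properties as Bool
open import Data.Nat.Base as ℕ using (ℕ; zero; suc)
open import Data.Nat.Divisibility using (_∣?_)
open import Data.Nat.GeneralisedArithmetic using (iterate)
open import Data.Product.Base using (∃; _×_; _,_)
open import Data.Sign.Base using (Sign)
open import Data.Sum.Base using (_⊎_; inj₁; inj₂)
open import Data.Vec.Base using (Vec; []; _∷_; lookup)
import Data.Vec.Properties as Vec
open import Function.Base using (_∘_)
open import Function.Bundles using (_⇔_; module Equivalence)
open import Function.Consequences.Propositional
  using (strictlySurjective⇒surjective; surjective⇒strictlySurjective)
open import Function.Definitions using (Injective; Surjective; Bijective)
open import Level using (Level)
open import Relation.Binary.PropositionalEquality
  using (_≡_; _≢_; refl; cong)
open import Relation.Binary.Definitions using (DecidableEquality)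
open import Relation.Nullary using (¬_; Dec; yes; no; ¬?; contradiction-irr)
open import Relation.Nullary.Decidable as Dec using (_×-dec_; _→-dec_; recompute)
open import Relation.Unary using (Pred; Decidable)

private
  variable
    a ℓ : Level
    A : Set a
    m n : ℕ

_≟ˢ_ : DecidableEquality (Subset n)
_≟ˢ_ = Vec.≡-dec Bool._≟_

image : (Fin m → Fin n) → Subset n
image f = ⋃ (map (⁅_⁆ ∘ f) (allFin _))

∏[_]_ : Subset n → (Fin n → ℤ) → ℤ
∏[ S ] f = foldr _*_ 1ℤ (map f (filter (_∈? S) (allFin _)))

-- The orbit of v ∈ Fin n is {v, π v, …, π^(n-1) v}; further iterates repeat.
orbit : (Fin n → Fin n) → Fin n → Subset n
orbit {n} π v = image {n} (λ k → iterate π v (toℕ k))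

-- A cycle of a permutation, fixed points included, is given by its underlying
-- set of vertices, so that the length of a cycle S is ∣ S ∣.
cycles : (Fin n → Fin n) → List (Subset n)
cycles π = deduplicate _≟ˢ_ (map (orbit π) (allFin _))

record OrientedHypergraph : Set where
  field
    ∣V∣ ∣E∣ ∣I∣ : ℕ
    ς : Fin ∣I∣ → Fin ∣V∣
    ω : Fin ∣I∣ → Fin ∣E∣
    σ : Fin ∣I∣ → Sign

  V E I : Set
  V = Fin ∣V∣
  E = Fin ∣E∣
  I = Fin ∣I∣

bijective? : (f : Fin m → Fin n) → Dec (Bijective _≡_ _≡_ f)
bijective? f = injective? ×-dec surjective?
  where
  injective? : Dec (Injective _≡_ _≡_ f)
  injective? = Dec.map′ (λ p {x} {y} → p x y) (λ p x y → p {x} {y})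
    (all? λ x → all? λ y → (f x ≟ f y) →-dec (x ≟ y))
  surjective? : Dec (Surjective _≡_ _≡_ f)
  surjective? = Dec.map′ strictlySurjective⇒surjective surjective⇒strictlySurjective
    (all? λ y → any? λ x → f x ≟ y)

module _ (G : OrientedHypergraph) where
  open OrientedHypergraph G

  -- The step at v is (v, i_v, e_v, j_v, π(v)) with i_v = lookup i v,
  -- j_v = lookup j v, e_v = ω i_v and π(v) = ς j_v.
  record IsContributor (i j : Vec I ∣V∣) : Set where
    field
      tail-port  : ∀ v → ς (lookup i v) ≡ v
      attachment : ∀ v → ω (lookup i v) ≡ ω (lookup j v)
      bijective  : Bijective _≡_ _≡_ (λ v → ς (lookup j v))

  isContributor? : ∀ i j → Dec (IsContributor i j)
  isContributor? i j = Dec.map′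
    (λ (p , q , r) → record { tail-port = p ; attachment = q ; bijective = r })
    (λ c → let open IsContributor c in tail-port , attachment , bijective)
    ((all? λ v → ς (lookup i v) ≟ v)
      ×-dec (all? λ v → ω (lookup i v) ≟ ω (lookup j v))
      ×-dec bijective? (λ v → ς (lookup j v)))

  -- The proof is irrelevant so that contributors are equal exactly when their
  -- steps are.
  record Contributor : Set where
    constructor mkContributor
    field
      tails heads : Vec I ∣V∣
      .valid      : IsContributor tails heads

module _ {G : OrientedHypergraph} where
  open OrientedHypergraph G

  isContributor : (c : Contributor G) →
                  IsContributor G (Contributor.tails c) (Contributor.heads c)
  isContributor (mkContributor i j p) = recompute (isContributor? G i j) p

  module _ (c : Contributor G) where
    open Contributor c

    tail head : V → I
    tail = lookup tails
    head = lookup heads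

    edge : V → E
    edge v = ω (tail v)

    perm : V → V
    perm v = ς (head v)

    Backstep : Pred V _
    Backstep v = tail v ≡ head v

    backstep? : Decidable Backstep
    backstep? v = tail v ≟ head v

    -- Component and Negative are only meant for cycles S of perm.
    Component : Pred (Subset ∣V∣) _
    Component S = ∀ v → v ∈ S → ¬ Backstep v

    component? : Decidable Component
    component? S = all? λ v → (v ∈? S) →-dec ¬? (backstep? v)

    Negative : Pred (Subset ∣V∣) _
    Negative S =
      -1ℤ ^ ∣ S ∣ * (∏[ S ] λ v → (σ (tail v) ◃ 1) * (σ (head v) ◃ 1)) ≡ -1ℤ

    negative? : Decidable Negative
    negative? S = _ ℤ.≟ _

    ec nc bs : ℕ
    ec = length (filter (λ S → 2 ∣? ∣ S ∣) (cycles perm))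
    nc = length (filter negative? (filter component? (cycles perm)))
    bs = length (filter backstep? (allFin _))

    csgn : ℤ
    csgn = -1ℤ ^ (ec ℕ.+ nc ℕ.+ bs)

    EdgeMonic : Set
    EdgeMonic = ∀ v w → v ≢ w → edge v ≢ edge w

  TailEquivalent HeadEquivalent : Contributor G → Contributor G → Set
  TailEquivalent c d = image (tail c) ≡ image (tail d)
  HeadEquivalent c d = image (head c) ≡ image (head d)

  IsTailClass IsHeadClass : Pred (Contributor G) ℓ → Set ℓ
  IsTailClass N = ∃ λ c₀ → ∀ c → N c ⇔ TailEquivalent c₀ c
  IsHeadClass N = ∃ λ c₀ → ∀ c → N c ⇔ HeadEquivalent c₀ c

  EdgeMonicClass NonEdgeMonicClass : Pred (Contributor G) ℓ → Set ℓ
  EdgeMonicClass N = ∀ c → N c → EdgeMonic c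
  NonEdgeMonicClass N = ¬ EdgeMonicClass N

  class? : {N : Pred (Contributor G) ℓ} → IsTailClass N ⊎ IsHeadClass N → Decidable N
  class? (inj₁ (c₀ , N⇔)) c = let open Equivalence (N⇔ c) in
    Dec.map′ from to (image (tail c₀) ≟ˢ image (tail c))
  class? (inj₂ (c₀ , N⇔)) c = let open Equivalence (N⇔ c) in
    Dec.map′ from to (image (head c₀) ≟ˢ image (head c))

allVecs : List A → (n : ℕ) → List (Vec A n)
allVecs xs zero    = [] ∷ []
allVecs xs (suc n) = cartesianProductWith _∷_ xs (allVecs xs n)

module _ (G : OrientedHypergraph) where
  open OrientedHypergraph G

  contributorsFrom : List (Vec I ∣V∣ × Vec I ∣V∣) → List (Contributor G)
  contributorsFrom []             = []
  contributorsFrom ((i , j) ∷ xs) with isContributor? G i j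
  ... | yes p = mkContributor i j p ∷ contributorsFrom xs
  ... | no  _ = contributorsFrom xs

  contributors : List (Contributor G)
  contributors = contributorsFrom (cartesianProduct vecs vecs)
    where vecs = allVecs (allFin ∣I∣) ∣V∣

∑[_]_ : {G : OrientedHypergraph} {N : Pred (Contributor G) ℓ} →
        Decidable N → (Contributor G → ℤ) → ℤ
∑[_]_ {G = G} N? f = foldr _+_ 0ℤ (map f (filter N? (contributors G)))

-- Every contributor is listed exactly once in `contributors`.

∈-allVecs : {xs : List A} → (∀ x → x ∈ₗ xs) → (v : Vec A n) → v ∈ₗ allVecs xs n
∈-allVecs x∈ []      = here refl
∈-allVecs x∈ (x ∷ v) = ∈-cartesianProductWith⁺ _∷_ (x∈ x) (∈-allVecs x∈ v)

allVecs-unique : {xs : List A} → Unique xs → (n : ℕ) → Unique (allVecs xs n)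
allVecs-unique u zero    = [] ∷ []
allVecs-unique u (suc n) =
  Unique.cartesianProductWith⁺ _∷_ Vec.∷-injective u (allVecs-unique u n)

module _ {G : OrientedHypergraph} where
  open OrientedHypergraph G
  open Contributor

  ∈-contributorsFrom : ∀ {xs} (c : Contributor G) → (tails c , heads c) ∈ₗ xs →
                       c ∈ₗ contributorsFrom G xs
  ∈-contributorsFrom (mkContributor i j p) (here refl) with isContributor? G i j
  ... | yes _ = here refl
  ... | no ¬p = contradiction-irr p ¬p
  ∈-contributorsFrom {(i , j) ∷ _} c (there c∈) with isContributor? G i j
  ... | yes _ = there (∈-contributorsFrom c c∈)
  ... | no  _ = ∈-contributorsFrom c c∈

  contributorsFrom-All : ∀ {x xs} → All (x ≢_) xs →
                         All (λ c → x ≢ (tails c , heads c)) (contributorsFrom G xs)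
  contributorsFrom-All []                      = []
  contributorsFrom-All {xs = (i , j) ∷ _} (p ∷ ps) with isContributor? G i j
  ... | yes _ = p ∷ contributorsFrom-All ps
  ... | no  _ = contributorsFrom-All ps

  contributorsFrom-unique : ∀ {xs} → Unique xs → Unique (contributorsFrom G xs)
  contributorsFrom-unique []                       = []
  contributorsFrom-unique {(i , j) ∷ _} (p ∷ u) with isContributor? G i j
  ... | yes _ = All.map (λ x≢ c≡ → x≢ (cong (λ c → tails c , heads c) c≡))
                        (contributorsFrom-All p)
                ∷ contributorsFrom-unique u
  ... | no  _ = contributorsFrom-unique u

  ∈-contributors : (c : Contributor G) → c ∈ₗ contributors G
  ∈-contributors c = ∈-contributorsFrom c
    (∈-cartesianProduct⁺ (∈-allVecs ∈-allFin (tails c)) (∈-allVecs ∈-allFin (heads c)))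

  contributors-unique : Unique (contributors G)
  contributors-unique = contributorsFrom-unique (Unique.cartesianProduct⁺ u u)
    where u = allVecs-unique (Unique.allFin⁺ ∣I∣) ∣V∣

-- The backsteps together with the negative components contribute ∏ (− σ(i_v) σ(j_v))
-- over all vertices v, whatever the permutation, and (−1)^ec is (−1)^(∣V∣ + number of
-- cycles); hence csgn c = (−1)^(number of cycles) · ∏ σ(i_v) · ∏ σ(j_v). If e_v = e_w
-- with v ≠ w, exchanging the heads of the steps at v and w composes π with a
-- transposition, so it changes the parity of the number of cycles and reverses csgn.
-- This is an involution on the class: in a tail class e_v = e_w is the same for all
-- members, so v and w are fixed; in a head class one fixes two heads on a common edge
-- and exchanges them between the vertices π⁻¹(a) and π⁻¹(b), a and b being their ports.
module Submission where

open import Defs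
open import Algebra.Structures using (IsCommutativeMonoid)
open import Data.Bool.Base using (if_then_else_; true; false)
open import Data.Fin.Base using (Fin; toℕ; fromℕ<)
open import Data.Fin.Permutation.Components using (transpose; transpose-inverse)
open import Data.Fin.Properties using (_≟_; any?; pigeonhole; toℕ-fromℕ<; toℕ<n)
open import Data.Fin.Subset using (Subset; ⁅_⁆; ⋃; ∣_∣; _∈_; _∉_)
open import Data.Fin.Subset.Properties
  using (_∈?_; ⊆-antisym; x∈⁅x⁆; x∈⁅y⁆⇒x≡y; ∣⁅x⁆∣≡1; ∉⊥; x∈p∪q⁻; x∈p∪q⁺)
open import Data.Integer.Base using (ℤ; +0; 0ℤ; 1ℤ; -1ℤ; _◃_; _+_; _*_; _^_; -_)
import Data.Integer.Properties as ℤ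
open import Data.Integer.Tactic.RingSolver using (solve-∀)
open import Data.List.Base
  using (List; []; _∷_; [_]; _++_; concatMap; filter; foldr; length; map; allFin)
open import Data.List.Membership.Propositional using () renaming (_∈_ to _∈ₗ_)
open import Data.List.Membership.Propositional.Properties
  using (∈-allFin; ∈-map⁺; ∈-map⁻; ∈-filter⁺; ∈-filter⁻; ∈-deduplicate⁺; ∈-deduplicate⁻;
         ∈-concatMap⁺)
open import Data.List.Membership.Propositional.Properties.WithK using (unique∧set⇒bag)
open import Data.List.Properties using (map-cong; map-∘; length-map)
open import Data.List.Relation.Binary.BagAndSetEquality using (∼bag⇒↭)
open import Data.List.Relation.Binary.Permutation.Propositional using (_↭_; ↭⇒↭ₛ)
import Data.List.Relation.Binary.Permutation.Propositional.Properties as Perm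
import Data.List.Relation.Binary.Permutation.Setoid.Properties as PermSetoid
open import Data.List.Relation.Unary.All as All using (All; []; _∷_)
open import Data.List.Relation.Unary.AllPairs using (AllPairs; []; _∷_)
import Data.List.Relation.Unary.AllPairs.Properties as AllPairs
import Data.List.Relation.Unary.All.Properties as All
open import Data.List.Relation.Unary.Any as Any using (here; there)
open import Data.List.Relation.Unary.Unique.Propositional using (Unique)
import Data.List.Relation.Unary.Unique.Propositional.Properties as Unique
import Data.List.Relation.Unary.Unique.DecPropositional.Properties as DecUnique
open import Data.Nat.Base as ℕ using (ℕ; zero; suc; s<s)
open import Data.Nat.Divisibility using (_∣?_; ∣m+n∣m⇒∣n; ∣m∣n⇒∣m+n; ∣-refl)
open import Data.Nat.GeneralisedArithmetic using (iterate)
import Data.Nat.Properties as ℕ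
open import Data.Product.Base using (∃; _×_; _,_; proj₁; proj₂)
import Data.Sign.Base as Sign
open import Data.Sum.Base using (_⊎_; inj₁; inj₂)
open import Data.Vec.Base using (Vec; lookup; tabulate)
open import Data.Vec.Properties using (lookup∘tabulate; tabulate∘lookup; tabulate-cong)
open import Function.Base using (_∘_; case_of_)
open import Function.Bundles using (mk⇔; module Equivalence)
open import Function.Consequences.Propositional
  using (strictlySurjective⇒surjective; surjective⇒strictlySurjective)
open import Function.Definitions using (Injective; StrictlySurjective)
open import Level using (Level)
open import Relation.Binary.Core using (Rel)
open import Relation.Binary.PropositionalEquality
  using (_≡_; _≢_; _≗_; refl; sym; trans; cong; cong₂; subst; setoid; module ≡-Reasoning)
open import Relation.Nullary using (¬_; Dec; yes; no; does; ¬?; contradiction)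
open import Relation.Nullary.Decidable using (_×-dec_; dec-true; dec-false; decidable-stable)
open import Relation.Unary using (Pred; Decidable)

open ≡-Reasoning

private
  variable
    a ℓ : Level
    A B : Set a
    m n : ℕ
    xs ys : List A

-- Lists without repetition, products over lists, sign-reversing involutions.

unique-sameMembers⇒↭ : Unique xs → Unique ys → (∀ {x} → x ∈ₗ xs → x ∈ₗ ys) →
                       (∀ {x} → x ∈ₗ ys → x ∈ₗ xs) → xs ↭ ys
unique-sameMembers⇒↭ xs! ys! xs⊆ys ys⊆xs =
  ∼bag⇒↭ (unique∧set⇒bag xs! ys! (mk⇔ xs⊆ys ys⊆xs))

unique⇒allPairs : {R : Rel A ℓ} → Unique xs →
                  (∀ {x y} → x ∈ₗ xs → y ∈ₗ xs → x ≢ y → R x y) → AllPairs R xs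
unique⇒allPairs []         r = []
unique⇒allPairs (x∉ ∷ xs!) r =
  All.tabulate (λ y∈ → r (here refl) (there y∈) (All.lookup x∉ y∈))
  ∷ unique⇒allPairs xs! (λ x∈ y∈ → r (there x∈) (there y∈))

unique-map : {f : A → B} → Unique xs →
             (∀ {x y} → x ∈ₗ xs → y ∈ₗ xs → f x ≡ f y → x ≡ y) → Unique (map f xs)
unique-map xs! inj =
  AllPairs.map⁺ (unique⇒allPairs xs! λ x∈ y∈ x≢y fx≡fy → x≢y (inj x∈ y∈ fx≡fy))

foldr-↭ : {_∙_ : A → A → A} {ε : A} → IsCommutativeMonoid _≡_ _∙_ ε →
          xs ↭ ys → foldr _∙_ ε xs ≡ foldr _∙_ ε ys
foldr-↭ {A = A} isCM xs↭ys =
  PermSetoid.foldr-commMonoid (setoid A) isCM (↭⇒↭ₛ xs↭ys)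

∏ : (A → ℤ) → List A → ℤ
∏ f xs = foldr _*_ 1ℤ (map f xs)

∏-↭ : (f : A → ℤ) → xs ↭ ys → ∏ f xs ≡ ∏ f ys
∏-↭ f xs↭ys = foldr-↭ ℤ.*-1-isCommutativeMonoid (Perm.map⁺ f xs↭ys)

∏-cong : {f g : A → ℤ} (xs : List A) → (∀ {x} → x ∈ₗ xs → f x ≡ g x) → ∏ f xs ≡ ∏ g xs
∏-cong []       f≗g = refl
∏-cong (x ∷ xs) f≗g = cong₂ _*_ (f≗g (here refl)) (∏-cong xs (f≗g ∘ there))

∏-* : (f g : A → ℤ) (xs : List A) → ∏ (λ x → f x * g x) xs ≡ ∏ f xs * ∏ g xs
∏-* f g []       = refl
∏-* f g (x ∷ xs) = begin
  f x * g x * ∏ (λ x → f x * g x) xs ≡⟨ cong (f x * g x *_) (∏-* f g xs) ⟩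
  f x * g x * (∏ f xs * ∏ g xs)      ≡⟨ interchange (f x) (g x) (∏ f xs) (∏ g xs) ⟩
  f x * ∏ f xs * (g x * ∏ g xs)      ∎
  where
  interchange : ∀ i j k l → i * j * (k * l) ≡ i * k * (j * l)
  interchange = solve-∀

∏-++ : (f : A → ℤ) (xs ys : List A) → ∏ f (xs ++ ys) ≡ ∏ f xs * ∏ f ys
∏-++ f []       ys = sym (ℤ.*-identityˡ _)
∏-++ f (x ∷ xs) ys =
  trans (cong (f x *_) (∏-++ f xs ys)) (sym (ℤ.*-assoc (f x) (∏ f xs) (∏ f ys)))

∏-concatMap : (f : B → ℤ) (h : A → List B) (xs : List A) →
              ∏ f (concatMap h xs) ≡ ∏ (∏ f ∘ h) xs
∏-concatMap f h []       = refl
∏-concatMap f h (x ∷ xs) =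
  trans (∏-++ f (h x) (concatMap h xs)) (cong (∏ f (h x) *_) (∏-concatMap f h xs))

∏-filter : {P : Pred A ℓ} (P? : Decidable P) (f : A → ℤ) (xs : List A) →
           ∏ f (filter P? xs) ≡ ∏ (λ x → if does (P? x) then f x else 1ℤ) xs
∏-filter P? f []       = refl
∏-filter P? f (x ∷ xs) with does (P? x)
... | true  = cong (f x *_) (∏-filter P? f xs)
... | false = trans (∏-filter P? f xs) (sym (ℤ.*-identityˡ _))

∏-const : (i : ℤ) (xs : List A) → i ^ length xs ≡ ∏ (λ _ → i) xs
∏-const i []       = refl
∏-const i (x ∷ xs) = cong (i *_) (∏-const i xs)

-1^-filter : {P : Pred A ℓ} (P? : Decidable P) (xs : List A) →
             -1ℤ ^ length (filter P? xs) ≡ ∏ (λ x → if does (P? x) then -1ℤ else 1ℤ) xs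
-1^-filter P? xs = trans (∏-const -1ℤ (filter P? xs)) (∏-filter P? _ xs)

i≡-i⇒i≡0 : ∀ {i} → i ≡ - i → i ≡ 0ℤ
i≡-i⇒i≡0 {+0} _ = refl

foldr-+-neg : (f g : A → ℤ) (xs : List A) → (∀ {x} → x ∈ₗ xs → g x ≡ - f x) →
              foldr _+_ 0ℤ (map g xs) ≡ - foldr _+_ 0ℤ (map f xs)
foldr-+-neg f g []       g≗-f = refl
foldr-+-neg f g (x ∷ xs) g≗-f =
  trans (cong₂ _+_ (g≗-f (here refl)) (foldr-+-neg f g xs (g≗-f ∘ there)))
        (sym (ℤ.neg-distrib-+ (f x) _))

-- Being its own inverse on the list, `f` merely permutes the entries, so replacing `s` by `s ∘ f`
-- leaves the sum unchanged. It also negates the sum, and 0 is the only integer equal to its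
-- negative.
signReversingInvolution : (f : A → A) (s : A → ℤ) → Unique xs →
  (∀ {x} → x ∈ₗ xs → f x ∈ₗ xs) → (∀ {x} → x ∈ₗ xs → f (f x) ≡ x) →
  (∀ {x} → x ∈ₗ xs → s (f x) ≡ - s x) → foldr _+_ 0ℤ (map s xs) ≡ 0ℤ
signReversingInvolution {xs = xs} f s xs! closed involutive reversing = i≡-i⇒i≡0 (begin
  foldr _+_ 0ℤ (map s xs)         ≡⟨ foldr-↭ ℤ.+-0-isCommutativeMonoid (Perm.map⁺ s fxs↭xs) ⟨
  foldr _+_ 0ℤ (map s (map f xs)) ≡⟨ cong (foldr _+_ 0ℤ) (map-∘ xs) ⟨
  foldr _+_ 0ℤ (map (s ∘ f) xs)   ≡⟨ foldr-+-neg s (s ∘ f) xs reversing ⟩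
  - foldr _+_ 0ℤ (map s xs)       ∎)
  where
  fxs↭xs : map f xs ↭ xs
  fxs↭xs = unique-sameMembers⇒↭
    (unique-map xs! λ x∈ y∈ fx≡fy →
      trans (sym (involutive x∈)) (trans (cong f fx≡fy) (involutive y∈)))
    xs!
    (λ y∈ → case ∈-map⁻ f y∈ of λ { (x , x∈ , refl) → closed x∈ })
    (λ x∈ → subst (_∈ₗ map f xs) (involutive x∈) (∈-map⁺ f (closed x∈)))

-- Parity and the units of the integers.

-1^-parity : ∀ n → (if does (2 ∣? n) then -1ℤ else 1ℤ) ≡ - (-1ℤ ^ n)
-1^-parity zero          = refl
-1^-parity (suc zero)    = refl
-1^-parity (suc (suc n)) = trans step (trans (-1^-parity n) (square (-1ℤ ^ n)))
  where
  square : ∀ i → - i ≡ - (-1ℤ * (-1ℤ * i))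
  square = solve-∀
  step : (if does (2 ∣? (2 ℕ.+ n)) then -1ℤ else 1ℤ) ≡ (if does (2 ∣? n) then -1ℤ else 1ℤ)
  step with 2 ∣? n
  ... | yes 2∣n rewrite dec-true (2 ∣? (2 ℕ.+ n)) (∣m∣n⇒∣m+n ∣-refl 2∣n) = refl
  ... | no  2∤n rewrite dec-false (2 ∣? (2 ℕ.+ n)) (λ 2∣2+n → 2∤n (∣m+n∣m⇒∣n 2∣2+n ∣-refl)) = refl

IsUnit : ℤ → Set
IsUnit i = i ≡ 1ℤ ⊎ i ≡ -1ℤ

unit-* : ∀ {i j} → IsUnit i → IsUnit j → IsUnit (i * j)
unit-* (inj₁ refl) (inj₁ refl) = inj₁ refl
unit-* (inj₁ refl) (inj₂ refl) = inj₂ refl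
unit-* (inj₂ refl) (inj₁ refl) = inj₂ refl
unit-* (inj₂ refl) (inj₂ refl) = inj₁ refl

unit-sign : ∀ s → IsUnit (s ◃ 1)
unit-sign Sign.+ = inj₁ refl
unit-sign Sign.- = inj₂ refl

unit-∏ : {f : A → ℤ} → (∀ x → IsUnit (f x)) → ∀ xs → IsUnit (∏ f xs)
unit-∏ u []       = inj₁ refl
unit-∏ u (x ∷ xs) = unit-* (u x) (unit-∏ u xs)

unit-^ : ∀ n → IsUnit (-1ℤ ^ n)
unit-^ zero    = inj₁ refl
unit-^ (suc n) = unit-* (inj₂ refl) (unit-^ n)

unit-square : ∀ {i} → IsUnit i → i * i ≡ 1ℤ
unit-square (inj₁ refl) = refl
unit-square (inj₂ refl) = refl

-- This removes the test inside `Negative`: the quantity tested there is ±1, so the sign contributed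
-- to (-1)^nc is that quantity itself.
unit≡-1? : ∀ {i} → IsUnit i → (if does (i ℤ.≟ -1ℤ) then -1ℤ else 1ℤ) ≡ i
unit≡-1? (inj₁ refl) = refl
unit≡-1? (inj₂ refl) = refl

-- Unions and images of finite subsets.

∈-⋃⁺ : ∀ {x : Fin n} {S Ss} → x ∈ S → S ∈ₗ Ss → x ∈ ⋃ Ss
∈-⋃⁺ x∈S (here refl) = x∈p∪q⁺ (inj₁ x∈S)
∈-⋃⁺ x∈S (there S∈)  = x∈p∪q⁺ (inj₂ (∈-⋃⁺ x∈S S∈))

∈-⋃⁻ : ∀ {x : Fin n} Ss → x ∈ ⋃ Ss → ∃ λ S → x ∈ S × S ∈ₗ Ss
∈-⋃⁻ []       x∈ = contradiction x∈ ∉⊥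
∈-⋃⁻ (S ∷ Ss) x∈ with x∈p∪q⁻ S (⋃ Ss) x∈
... | inj₁ x∈S = S , x∈S , here refl
... | inj₂ x∈⋃ = let T , x∈T , T∈ = ∈-⋃⁻ Ss x∈⋃ in T , x∈T , there T∈

∈-image⁺ : (f : Fin m → Fin n) (k : Fin m) → f k ∈ image f
∈-image⁺ f k = ∈-⋃⁺ (x∈⁅x⁆ (f k)) (∈-map⁺ (⁅_⁆ ∘ f) (∈-allFin k))

∈-image⁻ : (f : Fin m → Fin n) {x : Fin n} → x ∈ image f → ∃ λ k → f k ≡ x
∈-image⁻ f x∈ with ∈-⋃⁻ (map (⁅_⁆ ∘ f) (allFin _)) x∈
... | S , x∈S , S∈ with ∈-map⁻ (⁅_⁆ ∘ f) S∈
... | k , _ , refl = k , sym (x∈⁅y⁆⇒x≡y (f k) x∈S)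

image-cong : {f g : Fin m → Fin n} → f ≗ g → image f ≡ image g
image-cong f≗g = cong ⋃ (map-cong (cong ⁅_⁆ ∘ f≗g) (allFin _))

image-∘ : (f : Fin m → Fin n) {g : Fin m → Fin m} → StrictlySurjective _≡_ g →
          image (f ∘ g) ≡ image f
image-∘ f {g} g-surjective = ⊆-antisym
  (λ x∈ → case ∈-image⁻ (f ∘ g) x∈ of λ { (k , refl) → ∈-image⁺ f (g k) })
  (λ x∈ → case ∈-image⁻ f x∈ of λ { (k , refl) →
    case g-surjective k of λ { (l , refl) → ∈-image⁺ (f ∘ g) l } })

-- Iterates, orbits and cycles of an injective map.

iterate-suc : (f : A → A) (x : A) (k : ℕ) → iterate f x (suc k) ≡ f (iterate f x k)
iterate-suc f x zero    = refl
iterate-suc f x (suc k) = iterate-suc f (f x) k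

iterate-closed : (P : Pred A ℓ) {f : A → A} → (∀ {x} → P x → P (f x)) →
                 ∀ {x} → P x → ∀ k → P (iterate f x k)
iterate-closed P closed px zero    = px
iterate-closed P closed px (suc k) = iterate-closed P closed (closed px) k

Reaches : (A → A) → A → A → Set _
Reaches f x y = ∃ λ k → iterate f x k ≡ y

reaches-step : {f : A → A} {x y : A} → Reaches f x y → Reaches f x (f y)
reaches-step {f = f} {x} (k , refl) = suc k , iterate-suc f x k

reaches-trans : {f : A → A} {x y z : A} → Reaches f x y → Reaches f y z → Reaches f x z
reaches-trans {f = f} {x} x→y (k , refl) = iterate-closed (Reaches f x) reaches-step x→y k

module Orbits {π : Fin n → Fin n} (π-injective : Injective _≡_ _≡_ π) where

  -- Injectivity strips `i` applications of `π` from both sides of the collision. What remains is a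
  -- return to `v` after j - i = 1 + p steps.
  iterate-cancel : ∀ v i j → i ℕ.< j → iterate π v i ≡ iterate π v j →
                   ∃ λ p → p ℕ.< j × iterate π v (suc p) ≡ v
  iterate-cancel v zero    (suc j) _         eq = j , ℕ.≤-refl , sym eq
  iterate-cancel v (suc i) (suc j) (s<s i<j) eq =
    let p , p<j , eq′ = iterate-cancel v i j i<j (π-injective
          (trans (sym (iterate-suc π v i)) (trans eq (iterate-suc π v j))))
    in p , ℕ.m<n⇒m<1+n p<j , eq′

  -- Two of the n + 1 iterates with exponents 0, ..., n coincide. The larger exponent is at most n,
  -- hence so is the period 1 + p; this is why the n iterates listed by `orbit` are enough.
  period : ∀ v → ∃ λ p → p ℕ.< n × iterate π v (suc p) ≡ v
  period v with pigeonhole (ℕ.n<1+n n) (λ i → iterate π v (toℕ i))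
  ... | i , j , i<j , eq =
    let p , p<j , eq′ = iterate-cancel v (toℕ i) (toℕ j) i<j eq
    in p , ℕ.<-≤-trans p<j (ℕ.≤-pred (toℕ<n j)) , eq′

  -- While walking from `u`, the property that the current point leads back to `u` is kept: each
  -- step shortens the remaining way by one.
  reaches-sym : ∀ {u v} → Reaches π u v → Reaches π v u
  reaches-sym {u} (k , refl) = iterate-closed (λ v → Reaches π v u) closed (0 , refl) k
    where
    closed : ∀ {v} → Reaches π v u → Reaches π (π v) u
    -- The walk stands at `u` itself, so the way back from `π u` is the rest of a full period.
    closed (zero  , refl) = let p , _ , eq = period u in p , eq
    closed (suc k , eq)   = k , eq

  ∈-orbit⁻ : ∀ {u v} → v ∈ orbit π u → Reaches π u v
  ∈-orbit⁻ {u} v∈ = let k , eq = ∈-image⁻ {m = n} (λ i → iterate π u (toℕ i)) v∈ in toℕ k , eq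

  -- With 1 + p a period of `u`, every iterate has an exponent at most p: the exponent grows with
  -- each step and wraps from p to 0. Then p < n puts it in the range of `orbit`.
  ∈-orbit⁺ : ∀ {u v} → Reaches π u v → v ∈ orbit π u
  ∈-orbit⁺ {u} (k , refl) with period u
  ... | p , p<n , π^1+p≡u =
    let j , j≤p , eq = iterate-closed (λ v → ∃ λ j → j ℕ.≤ p × iterate π u j ≡ v)
                         closed (0 , ℕ.z≤n , refl) k
        j<n = ℕ.≤-<-trans j≤p p<n
    in subst (_∈ orbit π u) (trans (cong (iterate π u) (toℕ-fromℕ< j<n)) eq)
         (∈-image⁺ (λ i → iterate π u (toℕ i)) (fromℕ< j<n))
    where
    closed : ∀ {v} → (∃ λ j → j ℕ.≤ p × iterate π u j ≡ v) →
             ∃ λ j → j ℕ.≤ p × iterate π u j ≡ π v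
    closed (j , j≤p , refl) with j ℕ.≟ p
    ... | yes refl = 0 , ℕ.z≤n , trans (sym π^1+p≡u) (iterate-suc π u j)
    ... | no  j≢p  = suc j , ℕ.≤∧≢⇒< j≤p j≢p , iterate-suc π u j

  v∈orbit : ∀ v → v ∈ orbit π v
  v∈orbit v = ∈-orbit⁺ (0 , refl)

  orbit-≡ : ∀ {u v} → Reaches π u v → orbit π u ≡ orbit π v
  orbit-≡ u→v = ⊆-antisym
    (λ x∈ → ∈-orbit⁺ (reaches-trans (reaches-sym u→v) (∈-orbit⁻ x∈)))
    (λ x∈ → ∈-orbit⁺ (reaches-trans u→v (∈-orbit⁻ x∈)))

  orbit-fixed : ∀ {v} → π v ≡ v → orbit π v ≡ ⁅ v ⁆
  orbit-fixed {v} πv≡v = ⊆-antisym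
    (λ x∈ → case ∈-orbit⁻ x∈ of λ { (k , refl) →
      iterate-closed (_∈ ⁅ v ⁆) (λ x∈ → subst (_∈ ⁅ v ⁆)
        (trans (sym πv≡v) (cong π (sym (x∈⁅y⁆⇒x≡y v x∈)))) (x∈⁅x⁆ v)) (x∈⁅x⁆ v) k })
    (λ x∈ → subst (_∈ orbit π v) (sym (x∈⁅y⁆⇒x≡y v x∈)) (v∈orbit v))

  orbit∈cycles : ∀ v → orbit π v ∈ₗ cycles π
  orbit∈cycles v = ∈-deduplicate⁺ _≟ˢ_ (∈-map⁺ (orbit π) (∈-allFin v))

  ∈-cycles⁻ : ∀ {S} → S ∈ₗ cycles π → ∃ λ v → S ≡ orbit π v
  ∈-cycles⁻ S∈ =
    let v , _ , eq = ∈-map⁻ (orbit π) (∈-deduplicate⁻ _≟ˢ_ (map (orbit π) (allFin _)) S∈)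
    in v , eq

  cycle≡orbit : ∀ {S v} → S ∈ₗ cycles π → v ∈ S → S ≡ orbit π v
  cycle≡orbit S∈ v∈S with ∈-cycles⁻ S∈
  ... | u , refl = orbit-≡ (∈-orbit⁻ v∈S)

  cycles-unique : Unique (cycles π)
  cycles-unique = DecUnique.deduplicate-! _≟ˢ_ (map (orbit π) (allFin n))

  -- The cycles partition the vertices: each vertex lies in its own orbit, and two cycles that share
  -- a vertex both equal the orbit of that vertex.
  ∏-cycles : (f : Fin n → ℤ) → ∏ (λ S → ∏[ S ] f) (cycles π) ≡ ∏ f (allFin n)
  ∏-cycles f = begin
    ∏ (∏ f ∘ members) (cycles π)      ≡⟨ ∏-concatMap f members (cycles π) ⟨
    ∏ f (concatMap members (cycles π)) ≡⟨ ∏-↭ f partition ⟩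
    ∏ f (allFin n)                    ∎
    where
    members : Subset n → List (Fin n)
    members S = filter (_∈? S) (allFin n)
    disjoint : ∀ {S T} → S ∈ₗ cycles π → T ∈ₗ cycles π → S ≢ T →
               ∀ {v} → ¬ (v ∈ₗ members S × v ∈ₗ members T)
    disjoint {S} {T} S∈ T∈ S≢T (v∈S , v∈T) = S≢T (trans
      (cycle≡orbit S∈ (proj₂ (∈-filter⁻ (_∈? S) {xs = allFin n} v∈S)))
      (sym (cycle≡orbit T∈ (proj₂ (∈-filter⁻ (_∈? T) {xs = allFin n} v∈T)))))
    partition : concatMap members (cycles π) ↭ allFin n
    partition = unique-sameMembers⇒↭
      (Unique.concat⁺
        (All.map⁺ (All.tabulate λ {S} _ → Unique.filter⁺ (_∈? S) (Unique.allFin⁺ n)))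
        (AllPairs.map⁺ (unique⇒allPairs cycles-unique disjoint)))
      (Unique.allFin⁺ n)
      (λ {v} _ → ∈-allFin v)
      (λ {v} _ → ∈-concatMap⁺ members (Any.map
        (λ { refl → ∈-filter⁺ (_∈? orbit π v) (∈-allFin v) (v∈orbit v) }) (orbit∈cycles v)))

-- The effect of a transposition on the number of cycles.

-- Stated pointwise rather than as `ρ` = `π` ∘ (v w), the relation is visibly symmetric in `π` and
-- `ρ`, so a one-sided argument about cycles can be reused in the other direction.
record SwapsAt (v w : Fin n) (π ρ : Fin n → Fin n) : Set where
  field
    at-v      : ρ v ≡ π w
    at-w      : ρ w ≡ π v
    elsewhere : ∀ {u} → u ≢ v → u ≢ w → ρ u ≡ π u

swapsAt-sym : ∀ {v w : Fin n} {π ρ} → SwapsAt v w π ρ → SwapsAt v w ρ π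
swapsAt-sym s = record
  { at-v      = sym at-w
  ; at-w      = sym at-v
  ; elsewhere = λ u≢v u≢w → sym (elsewhere u≢v u≢w)
  } where open SwapsAt s

-- Following π from u, the first element of {v , w} that is met is t.
data Hits {n} (v w : Fin n) (π : Fin n → Fin n) (t : Fin n) : Fin n → Set where
  here : Hits v w π t t
  step : ∀ {u} → u ≢ v → u ≢ w → Hits v w π t (π u) → Hits v w π t u

module _ {v w : Fin n} {π : Fin n → Fin n} where

  hits-first : ∀ u k → iterate π u k ≡ v → Hits v w π v u ⊎ Hits v w π w u
  hits-first u zero    refl = inj₁ here
  hits-first u (suc k) eq with u ≟ v | u ≟ w
  ... | yes refl | _        = inj₁ here
  ... | no  _    | yes refl = inj₂ here
  ... | no  u≢v  | no  u≢w  with hits-first (π u) k eq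
  ...   | inj₁ h = inj₁ (step u≢v u≢w h)
  ...   | inj₂ h = inj₂ (step u≢v u≢w h)

  hits⇒reaches : ∀ {t u} → Hits v w π t u → Reaches π u t
  hits⇒reaches here         = 0 , refl
  hits⇒reaches (step _ _ h) = let k , eq = hits⇒reaches h in suc k , eq

  -- The path applies `π` only at vertices outside {v , w}, exactly where `π` and `ρ` agree.
  hits-transfer : ∀ {ρ t u} → SwapsAt v w π ρ → Hits v w π t u → Hits v w ρ t u
  hits-transfer s here             = here
  hits-transfer s (step u≢v u≢w h) = step u≢v u≢w
    (subst (Hits v w _ _) (sym (SwapsAt.elsewhere s u≢v u≢w)) (hits-transfer s h))

  hits-closed : ∀ {t} → Hits v w π t (π t) → ∀ {u} → Hits v w π t u → Hits v w π t (π u)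
  hits-closed loop here         = loop
  hits-closed loop (step _ _ h) = h

  -- If the path from `π v` comes back to `v` first, the vertices whose first hit is `v` form a set
  -- closed under `π`. It contains `v` but not `w`, because a path starting at `w` hits `w` at once.
  hits-v⇒¬reaches-w : v ≢ w → Hits v w π v (π v) → ¬ Reaches π v w
  hits-v⇒¬reaches-w v≢w loop (k , eq) =
    case subst (Hits v w π v) eq (iterate-closed (Hits v w π v) (hits-closed loop) here k) of λ
      { here           → v≢w refl
      ; (step _ w≢w _) → w≢w refl }

  hits-w⇒¬reaches-v : v ≢ w → Hits v w π w (π w) → ¬ Reaches π w v
  hits-w⇒¬reaches-v v≢w loop (k , eq) =
    case subst (Hits v w π w) eq (iterate-closed (Hits v w π w) (hits-closed loop) here k) of λ
      { here           → v≢w refl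
      ; (step v≢v _ _) → v≢v refl }

module CycleCount {v w : Fin n} (v≢w : v ≢ w) where

  -- Cycles through neither `v` nor `w` are common to both maps. The comparison of the cycle counts
  -- thus reduces to whether `v` and `w` share a cycle (one further cycle) or not (two).
  Avoids : Pred (Subset n) _
  Avoids S = v ∉ S × w ∉ S

  avoids? : Decidable Avoids
  avoids? S = ¬? (v ∈? S) ×-dec ¬? (w ∈? S)

  others : (Fin n → Fin n) → List (Subset n)
  others π = filter avoids? (cycles π)

  module _ {π : Fin n → Fin n} (π-injective : Injective _≡_ _≡_ π) where
    open Orbits π-injective

    others-unique : Unique (others π)
    others-unique = Unique.filter⁺ avoids? cycles-unique

    ∈-others : ∀ {S} → S ∈ₗ others π → S ∈ₗ cycles π × Avoids S
    ∈-others = ∈-filter⁻ avoids? {xs = cycles π}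

    orbit-v≢others : All (orbit π v ≢_) (others π)
    orbit-v≢others = All.tabulate λ S∈ eq →
      proj₁ (proj₂ (∈-others S∈)) (subst (v ∈_) eq (v∈orbit v))

    orbit-w≢others : All (orbit π w ≢_) (others π)
    orbit-w≢others = All.tabulate λ S∈ eq →
      proj₂ (proj₂ (∈-others S∈)) (subst (w ∈_) eq (v∈orbit w))

    cycles⊆ : ∀ {S} → S ∈ₗ cycles π → S ∈ₗ orbit π v ∷ orbit π w ∷ others π
    cycles⊆ {S} S∈ with v ∈? S | w ∈? S
    ... | yes v∈S | _       = here (cycle≡orbit S∈ v∈S)
    ... | no  _   | yes w∈S = there (here (cycle≡orbit S∈ w∈S))
    ... | no  v∉S | no  w∉S = there (there (∈-filter⁺ avoids? S∈ (v∉S , w∉S)))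

    length-together : Reaches π v w → length (cycles π) ≡ 1 ℕ.+ length (others π)
    length-together v→w = Perm.↭-length (unique-sameMembers⇒↭ cycles-unique
      (orbit-v≢others ∷ others-unique)
      (λ S∈ → case cycles⊆ S∈ of λ
        { (here eq)         → here eq
        ; (there (here eq)) → here (trans eq (sym (orbit-≡ v→w)))
        ; (there (there p)) → there p })
      (λ { (here refl) → orbit∈cycles v ; (there S∈) → proj₁ (∈-others S∈) }))

    length-apart : ¬ Reaches π v w → length (cycles π) ≡ 2 ℕ.+ length (others π)
    length-apart v↛w = Perm.↭-length (unique-sameMembers⇒↭ cycles-unique
      ((orbit-v≢orbit-w ∷ orbit-v≢others) ∷ orbit-w≢others ∷ others-unique)
      cycles⊆
      (λ { (here refl)         → orbit∈cycles v
         ; (there (here refl)) → orbit∈cycles w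
         ; (there (there S∈))  → proj₁ (∈-others S∈) }))
      where
      orbit-v≢orbit-w : orbit π v ≢ orbit π w
      orbit-v≢orbit-w eq = v↛w (∈-orbit⁻ (subst (w ∈_) (sym eq) (v∈orbit w)))

  iterate-avoiding : ∀ {π ρ} → SwapsAt v w π ρ → ∀ u →
    (∀ k → iterate π u k ≢ v) → (∀ k → iterate π u k ≢ w) →
    ∀ k → iterate π u k ≡ iterate ρ u k
  iterate-avoiding s u ≢v ≢w zero    = refl
  iterate-avoiding {π} {ρ} s u ≢v ≢w (suc k) = trans
    (iterate-avoiding s (π u) (≢v ∘ suc) (≢w ∘ suc) k)
    (cong (λ x → iterate ρ x k) (sym (SwapsAt.elsewhere s (≢v 0) (≢w 0))))

  -- Such a cycle is the orbit of some `u` none of whose `π`-iterates is `v` or `w`, so the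
  -- `ρ`-iterates of `u` are the same points.
  others⊆ : ∀ {π ρ} → Injective _≡_ _≡_ π → Injective _≡_ _≡_ ρ → SwapsAt v w π ρ →
            ∀ {S} → S ∈ₗ others π → S ∈ₗ others ρ
  others⊆ {π} {ρ} π-inj ρ-inj s S∈ with ∈-others π-inj S∈
  ... | S∈cycles , avoids with Orbits.∈-cycles⁻ π-inj S∈cycles
  ...   | u , refl = ∈-filter⁺ avoids?
    (subst (_∈ₗ cycles ρ) (sym orbit≡) (Orbits.orbit∈cycles ρ-inj u)) avoids
    where
    orbit≡ : orbit π u ≡ orbit ρ u
    orbit≡ = image-cong {m = n} λ k → iterate-avoiding s u
      (λ k eq → proj₁ avoids (Orbits.∈-orbit⁺ π-inj (k , eq)))
      (λ k eq → proj₂ avoids (Orbits.∈-orbit⁺ π-inj (k , eq))) (toℕ k)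

  module _ {π ρ} (π-inj : Injective _≡_ _≡_ π) (ρ-inj : Injective _≡_ _≡_ ρ)
           (s : SwapsAt v w π ρ) where
    open SwapsAt s

    length-others : length (others π) ≡ length (others ρ)
    length-others = Perm.↭-length (unique-sameMembers⇒↭
      (others-unique π-inj) (others-unique ρ-inj)
      (others⊆ π-inj ρ-inj s) (others⊆ ρ-inj π-inj (swapsAt-sym s)))

    -- The π-path from π v = ρ w returns to {v , w}, first at v or first at w,
    -- and up to that point it is also a ρ-path. In the first case ρ merges the
    -- two π-cycles of v and w; in the second it splits their common π-cycle.
    -1^cycles-flips : -1ℤ ^ length (cycles ρ) ≡ - (-1ℤ ^ length (cycles π))
    -1^cycles-flips with Orbits.period π-inj v
    ... | p , _ , π^1+p≡v with hits-first {w = w} {π = π} (π v) p π^1+p≡v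
    ...   | inj₁ h = begin
      -1ℤ ^ length (cycles ρ)           ≡⟨ cong (-1ℤ ^_) (length-together ρ-inj v→ρw) ⟩
      -1ℤ ^ (1 ℕ.+ length (others ρ))   ≡⟨ cong (λ k → -1ℤ ^ (1 ℕ.+ k)) length-others ⟨
      -1ℤ ^ (1 ℕ.+ length (others π))   ≡⟨ flip (-1ℤ ^ length (others π)) ⟩
      - (-1ℤ ^ (2 ℕ.+ length (others π))) ≡⟨ cong (λ k → - (-1ℤ ^ k)) (length-apart π-inj v↛πw) ⟨
      - (-1ℤ ^ length (cycles π))       ∎
      where
      v↛πw : ¬ Reaches π v w
      v↛πw = hits-v⇒¬reaches-w v≢w h
      v→ρw : Reaches ρ v w
      -- From `w`, one `ρ`-step leads to `π v`, and the transferred path continues to `v`; hence the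
      -- exponent `suc k`. Symmetry of reachability turns this around.
      v→ρw = Orbits.reaches-sym ρ-inj (let k , eq = hits⇒reaches (hits-transfer s h)
        in suc k , trans (cong (λ x → iterate ρ x k) at-w) eq)
      flip : ∀ i → -1ℤ * i ≡ - (-1ℤ * (-1ℤ * i))
      flip = solve-∀
    ...   | inj₂ h = begin
      -1ℤ ^ length (cycles ρ)           ≡⟨ cong (-1ℤ ^_) (length-apart ρ-inj v↛ρw) ⟩
      -1ℤ ^ (2 ℕ.+ length (others ρ))   ≡⟨ cong (λ k → -1ℤ ^ (2 ℕ.+ k)) length-others ⟨
      -1ℤ ^ (2 ℕ.+ length (others π))   ≡⟨ flip (-1ℤ ^ length (others π)) ⟩
      - (-1ℤ ^ (1 ℕ.+ length (others π))) ≡⟨ cong (λ k → - (-1ℤ ^ k)) (length-together π-inj v→πw) ⟨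
      - (-1ℤ ^ length (cycles π))       ∎
      where
      v→πw : Reaches π v w
      v→πw = let k , eq = hits⇒reaches h in suc k , eq
      v↛ρw : ¬ Reaches ρ v w
      v↛ρw v→w = hits-w⇒¬reaches-v v≢w
        (subst (Hits v w ρ w) (sym at-w) (hits-transfer s h)) (Orbits.reaches-sym ρ-inj v→w)
      flip : ∀ i → -1ℤ * (-1ℤ * i) ≡ - (-1ℤ * i)
      flip = solve-∀

-- Transpositions, singletons and vectors.

transpose-matchˡ : (v w : Fin n) → transpose v w v ≡ w
transpose-matchˡ v w rewrite dec-true (v ≟ v) refl = refl

transpose-matchʳ : (v w : Fin n) → transpose v w w ≡ v
transpose-matchʳ v w with w ≟ v
... | yes refl = refl
... | no  _ rewrite dec-true (w ≟ w) refl = refl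

transpose-mismatch : {u v w : Fin n} → u ≢ v → u ≢ w → transpose v w u ≡ u
transpose-mismatch {u = u} {v} {w} u≢v u≢w
  rewrite dec-false (u ≟ v) u≢v | dec-false (u ≟ w) u≢w = refl

transpose-comm : (v w u : Fin n) → transpose v w u ≡ transpose w v u
transpose-comm v w u = cases (u ≟ v) (u ≟ w)
  where
  cases : Dec (u ≡ v) → Dec (u ≡ w) → transpose v w u ≡ transpose w v u
  cases (yes refl) _          = trans (transpose-matchˡ u w) (sym (transpose-matchʳ w u))
  cases (no _)     (yes refl) = trans (transpose-matchʳ v u) (sym (transpose-matchˡ u v))
  cases (no u≢v)   (no u≢w)   =
    trans (transpose-mismatch u≢v u≢w) (sym (transpose-mismatch u≢w u≢v))

transpose-injective : (v w : Fin n) → Injective _≡_ _≡_ (transpose v w)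
transpose-injective v w eq = trans (sym (transpose-inverse w v))
  (trans (cong (transpose w v) eq) (transpose-inverse w v))

transpose-surjective : (v w : Fin n) → StrictlySurjective _≡_ (transpose v w)
transpose-surjective v w u = transpose w v u , transpose-inverse v w

members-⁅⁆ : (v : Fin n) → filter (_∈? ⁅ v ⁆) (allFin n) ↭ [ v ]
members-⁅⁆ v = unique-sameMembers⇒↭
  (Unique.filter⁺ (_∈? ⁅ v ⁆) (Unique.allFin⁺ _)) ([] ∷ [])
  (λ u∈ → here (x∈⁅y⁆⇒x≡y v (proj₂ (∈-filter⁻ (_∈? ⁅ v ⁆) {xs = allFin _} u∈))))
  (λ { (here refl) → ∈-filter⁺ (_∈? ⁅ v ⁆) (∈-allFin v) (x∈⁅x⁆ v) })

lookup-injective : (xs ys : Vec A n) → lookup xs ≗ lookup ys → xs ≡ ys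
lookup-injective xs ys eq =
  trans (sym (tabulate∘lookup xs)) (trans (tabulate-cong eq) (tabulate∘lookup ys))

-- The contributor sign in terms of the number of cycles.

module _ {G : OrientedHypergraph} where
  open OrientedHypergraph G

  contributor-≡ : {c d : Contributor G} → tail c ≗ tail d → head c ≗ head d → c ≡ d
  contributor-≡ {mkContributor i j _} {mkContributor i′ j′ _} i≗i′ j≗j′
    with refl ← lookup-injective i i′ i≗i′ | refl ← lookup-injective j j′ j≗j′ = refl

  module _ (c : Contributor G) where
    open IsContributor (isContributor c)

    perm-injective : Injective _≡_ _≡_ (perm c)
    perm-injective = proj₁ bijective

    perm⁻¹ : V → V
    perm⁻¹ v = proj₁ (surjective⇒strictlySurjective (proj₂ bijective) v)

    perm-perm⁻¹ : ∀ v → perm c (perm⁻¹ v) ≡ v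
    perm-perm⁻¹ v = proj₂ (surjective⇒strictlySurjective (proj₂ bijective) v)

    perm⁻¹-unique : ∀ {u v} → perm c u ≡ v → perm⁻¹ v ≡ u
    perm⁻¹-unique eq = perm-injective (trans (perm-perm⁻¹ _) (sym eq))

    open Orbits perm-injective

    ⟦_⟧ : (V → I) → V → ℤ
    ⟦ f ⟧ v = σ (f v) ◃ 1

    incidenceSign : V → ℤ
    incidenceSign v = ⟦ tail c ⟧ v * ⟦ head c ⟧ v

    backstep⇒fixed : ∀ {v} → Backstep c v → perm c v ≡ v
    backstep⇒fixed {v} b = trans (cong ς (sym b)) (tail-port v)

    backstep⇒orbit : ∀ {v} → Backstep c v → orbit (perm c) v ≡ ⁅ v ⁆
    backstep⇒orbit b = orbit-fixed (backstep⇒fixed b)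

    -- A backstep at `v` fixes `v`, so {v} is a whole cycle and distinct backsteps give distinct
    -- cycles. Conversely a cycle that is not a component contains a backstep. Counting backsteps by
    -- cycles lets `bs` join `ec` and `nc` in a single product over cycles.
    bs≡nonComponents : bs c ≡ length (filter (¬? ∘ component? c) (cycles (perm c)))
    bs≡nonComponents = trans (sym (length-map (orbit (perm c)) (filter (backstep? c) (allFin _))))
      (Perm.↭-length (unique-sameMembers⇒↭
        {xs = map (orbit (perm c)) (filter (backstep? c) (allFin _))}
        (unique-map (Unique.filter⁺ (backstep? c) (Unique.allFin⁺ _)) orbits-differ)
        (Unique.filter⁺ (¬? ∘ component? c) cycles-unique)
        nonComponent backstepOrbit))
      where
      isBackstep : ∀ {v} → v ∈ₗ filter (backstep? c) (allFin _) → Backstep c v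
      isBackstep v∈ = proj₂ (∈-filter⁻ (backstep? c) {xs = allFin _} v∈)

      orbits-differ : ∀ {u v} → u ∈ₗ filter (backstep? c) (allFin _) →
                      v ∈ₗ filter (backstep? c) (allFin _) →
                      orbit (perm c) u ≡ orbit (perm c) v → u ≡ v
      orbits-differ {u} {v} u∈ v∈ eq = x∈⁅y⁆⇒x≡y v
        (subst (u ∈_) (trans eq (backstep⇒orbit (isBackstep v∈))) (v∈orbit u))

      nonComponent : ∀ {S} → S ∈ₗ map (orbit (perm c)) (filter (backstep? c) (allFin _)) →
                     S ∈ₗ filter (¬? ∘ component? c) (cycles (perm c))
      nonComponent S∈ with ∈-map⁻ (orbit (perm c)) S∈
      ... | v , v∈ , refl = ∈-filter⁺ (¬? ∘ component? c) (orbit∈cycles v)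
        (λ comp → comp v (v∈orbit v) (isBackstep v∈))

      backstepOrbit : ∀ {S} → S ∈ₗ filter (¬? ∘ component? c) (cycles (perm c)) →
                      S ∈ₗ map (orbit (perm c)) (filter (backstep? c) (allFin _))
      backstepOrbit {S} S∈ with ∈-filter⁻ (¬? ∘ component? c) {xs = cycles (perm c)} S∈
      -- The negation of `Component` carries no witness; a search through the vertices supplies the
      -- backstep.
      ... | S∈cycles , ¬comp with any? (λ v → (v ∈? S) ×-dec backstep? c v)
      ...   | yes (v , v∈S , b) = subst (_∈ₗ _) (sym (cycle≡orbit S∈cycles v∈S))
        (∈-map⁺ (orbit (perm c)) (∈-filter⁺ (backstep? c) (∈-allFin v) b))
      ...   | no ∄v = contradiction (λ v v∈S b → ∄v (v , v∈S , b)) ¬comp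

    -- The factors by which one cycle enters (-1)^ec, (-1)^nc and (-1)^bs.
    even negative nonComponent : Subset ∣V∣ → ℤ
    even S         = if does (2 ∣? ∣ S ∣) then -1ℤ else 1ℤ
    negative S     = if does (component? c S)
                     then (if does (negative? c S) then -1ℤ else 1ℤ) else 1ℤ
    nonComponent S = if does (¬? (component? c S)) then -1ℤ else 1ℤ

    cycleSign : Subset ∣V∣ → ℤ
    cycleSign S = even S * negative S * nonComponent S

    csgn≡∏cycleSign : csgn c ≡ ∏ cycleSign (cycles (perm c))
    csgn≡∏cycleSign = begin
      -1ℤ ^ (ec c ℕ.+ nc c ℕ.+ bs c)
        ≡⟨ ℤ.^-distribˡ-+-* -1ℤ (ec c ℕ.+ nc c) (bs c) ⟩
      -1ℤ ^ (ec c ℕ.+ nc c) * -1ℤ ^ bs c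
        ≡⟨ cong (_* -1ℤ ^ bs c) (ℤ.^-distribˡ-+-* -1ℤ (ec c) (nc c)) ⟩
      -1ℤ ^ ec c * -1ℤ ^ nc c * -1ℤ ^ bs c
        ≡⟨ cong₂ _*_ (cong₂ _*_ (-1^-filter (λ S → 2 ∣? ∣ S ∣) C) nc-∏) bs-∏ ⟩
      ∏ even C * ∏ negative C * ∏ nonComponent C
        ≡⟨ cong (_* ∏ nonComponent C) (∏-* even negative C) ⟨
      ∏ (λ S → even S * negative S) C * ∏ nonComponent C
        ≡⟨ ∏-* (λ S → even S * negative S) nonComponent C ⟨
      ∏ cycleSign C ∎
      where
      C : List (Subset ∣V∣)
      C = cycles (perm c)
      nc-∏ : -1ℤ ^ nc c ≡ ∏ negative C
      nc-∏ = trans (-1^-filter (negative? c) (filter (component? c) C))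
                   (∏-filter (component? c) _ C)
      bs-∏ : -1ℤ ^ bs c ≡ ∏ nonComponent C
      bs-∏ = trans (cong (-1ℤ ^_) bs≡nonComponents) (-1^-filter (¬? ∘ component? c) C)

    backstep⇒incidenceSign : ∀ {v} → Backstep c v → incidenceSign v ≡ 1ℤ
    backstep⇒incidenceSign {v} b =
      trans (cong (λ i → (σ (tail c v) ◃ 1) * (σ i ◃ 1)) (sym b))
            (unit-square (unit-sign (σ (tail c v))))

    -- The cycle {v} has odd length and is not a component, so only the -1 for the backstep
    -- survives. On the right, both incidences coincide and their signs multiply to 1.
    cycleSign-backstep : ∀ {v} → Backstep c v → cycleSign ⁅ v ⁆ ≡ -1ℤ * ∏[ ⁅ v ⁆ ] incidenceSign
    cycleSign-backstep {v} b
      rewrite dec-false (component? c ⁅ v ⁆) (λ comp → comp v (x∈⁅x⁆ v) b)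
            | ∣⁅x⁆∣≡1 v
            | ∏-↭ incidenceSign (members-⁅⁆ v)
            | backstep⇒incidenceSign b = refl

    -- For length k, the parity factor is -(-1)^k and the negativity factor is (-1)^k times the
    -- product of the incidence signs; the two powers cancel.
    cycleSign-component : ∀ S → Component c S → cycleSign S ≡ -1ℤ * ∏[ S ] incidenceSign
    cycleSign-component S comp
      rewrite dec-true (component? c S) comp = begin
      even S * (if does (negative? c S) then -1ℤ else 1ℤ) * 1ℤ
        ≡⟨ cong (_* 1ℤ) (cong₂ _*_ (-1^-parity ∣ S ∣) (unit≡-1? (unit-* (unit-^ ∣ S ∣) unit-S))) ⟩
      - p * (p * ∏[ S ] incidenceSign) * 1ℤ ≡⟨ regroup p (∏[ S ] incidenceSign) ⟩
      p * p * (-1ℤ * ∏[ S ] incidenceSign)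
        ≡⟨ cong (_* (-1ℤ * ∏[ S ] incidenceSign)) (unit-square (unit-^ ∣ S ∣)) ⟩
      1ℤ * (-1ℤ * ∏[ S ] incidenceSign)     ≡⟨ ℤ.*-identityˡ _ ⟩
      -1ℤ * ∏[ S ] incidenceSign            ∎
      where
      p : ℤ
      p = -1ℤ ^ ∣ S ∣
      unit-S : IsUnit (∏[ S ] incidenceSign)
      unit-S = unit-∏ (λ v → unit-* (unit-sign (σ (tail c v))) (unit-sign (σ (head c v))))
                      (filter (_∈? S) (allFin _))
      regroup : ∀ i j → - i * (i * j) * 1ℤ ≡ i * i * (-1ℤ * j)
      regroup = solve-∀

    cycleSign-≡ : ∀ {S} → S ∈ₗ cycles (perm c) → cycleSign S ≡ -1ℤ * ∏[ S ] incidenceSign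
    cycleSign-≡ {S} S∈ with any? (λ v → (v ∈? S) ×-dec backstep? c v)
    ... | yes (v , v∈S , b) =
      subst (λ S → cycleSign S ≡ -1ℤ * ∏[ S ] incidenceSign)
        (sym (trans (cycle≡orbit S∈ v∈S) (backstep⇒orbit b))) (cycleSign-backstep b)
    ... | no ∄v = cycleSign-component S (λ v v∈S b → ∄v (v , v∈S , b))

    -- Tails and heads are separated because an exchange of heads keeps the tail product and only
    -- reorders the head product, so that the sign change can be read off the cycle count.
    csgn-≡ : csgn c ≡ -1ℤ ^ length (cycles (perm c)) *
                      (∏ ⟦ tail c ⟧ (allFin _) * ∏ ⟦ head c ⟧ (allFin _))
    csgn-≡ = begin
      csgn c                  ≡⟨ csgn≡∏cycleSign ⟩
      ∏ cycleSign C           ≡⟨ ∏-cong C cycleSign-≡ ⟩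
      ∏ (λ S → -1ℤ * ∏[ S ] incidenceSign) C
        ≡⟨ ∏-* (λ _ → -1ℤ) (λ S → ∏[ S ] incidenceSign) C ⟩
      ∏ (λ _ → -1ℤ) C * ∏ (λ S → ∏[ S ] incidenceSign) C
        ≡⟨ cong₂ _*_ (sym (∏-const -1ℤ C)) (∏-cycles incidenceSign) ⟩
      -1ℤ ^ length C * ∏ incidenceSign (allFin _)
        ≡⟨ cong (-1ℤ ^ length C *_) (∏-* ⟦ tail c ⟧ ⟦ head c ⟧ (allFin _)) ⟩
      -1ℤ ^ length C * (∏ ⟦ tail c ⟧ (allFin _) * ∏ ⟦ head c ⟧ (allFin _)) ∎
      where
      C : List (Subset ∣V∣)
      C = cycles (perm c)

  -- Exchanging the heads of two steps on a common edge.

  module Swap (c : Contributor G) (v w : V) (ev≡ew : edge c v ≡ edge c w) where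
    open IsContributor (isContributor c)

    τ : V → V
    τ = transpose v w

    swappedHeads : Vec I ∣V∣
    swappedHeads = tabulate (head c ∘ τ)

    lookup-swapped : ∀ u → lookup swappedHeads u ≡ head c (τ u)
    lookup-swapped = lookup∘tabulate (head c ∘ τ)

    edge-τ : ∀ u → edge c (τ u) ≡ edge c u
    edge-τ u = cases (u ≟ v) (u ≟ w)
      where
      cases : Dec (u ≡ v) → Dec (u ≡ w) → edge c (τ u) ≡ edge c u
      cases (yes refl) _          = trans (cong (edge c) (transpose-matchˡ v w)) (sym ev≡ew)
      cases (no _)     (yes refl) = trans (cong (edge c) (transpose-matchʳ v w)) ev≡ew
      cases (no u≢v)   (no u≢w)   = cong (edge c) (transpose-mismatch u≢v u≢w)

    swapped-valid : IsContributor G (Contributor.tails c) swappedHeads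
    swapped-valid = record
      { tail-port  = tail-port
      -- The new head at `u` comes from the step at `τ u`, which lies on the same edge as the step
      -- at `u`.
      ; attachment = λ u → trans (sym (edge-τ u))
          (trans (attachment (τ u)) (cong ω (sym (lookup-swapped u))))
      ; bijective  =
          (λ {x} {y} eq → transpose-injective v w (perm-injective c
            (trans (cong ς (sym (lookup-swapped x))) (trans eq (cong ς (lookup-swapped y))))))
        , strictlySurjective⇒surjective (λ y →
            transpose w v (perm⁻¹ c y)
          , trans (cong ς (lookup-swapped _))
              (trans (cong (perm c) (transpose-inverse v w)) (perm-perm⁻¹ c y)))
      }

    swap : Contributor G
    swap = mkContributor (Contributor.tails c) swappedHeads swapped-valid

    perm-swap : ∀ u → perm swap u ≡ perm c (τ u)
    perm-swap u = cong ς (lookup-swapped u)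

    perm-swap-v : perm swap v ≡ perm c w
    perm-swap-v = trans (perm-swap v) (cong (perm c) (transpose-matchˡ v w))

    perm-swap-w : perm swap w ≡ perm c v
    perm-swap-w = trans (perm-swap w) (cong (perm c) (transpose-matchʳ v w))

    swapsAt : SwapsAt v w (perm c) (perm swap)
    swapsAt = record
      { at-v      = perm-swap-v
      ; at-w      = perm-swap-w
      ; elsewhere = λ {u} u≢v u≢w →
          trans (perm-swap u) (cong (perm c) (transpose-mismatch u≢v u≢w))
      }

    image-head-swap : image (head swap) ≡ image (head c)
    image-head-swap =
      trans (image-cong lookup-swapped) (image-∘ (head c) (transpose-surjective v w))

    ∏-head-swap : ∏ (⟦_⟧ swap (head swap)) (allFin _) ≡ ∏ (⟦_⟧ c (head c)) (allFin _)
    ∏-head-swap = begin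
      ∏ (λ u → σ (head swap u) ◃ 1) (allFin _)
        ≡⟨ ∏-cong (allFin _) (λ {u} _ → cong (λ i → σ i ◃ 1) (lookup-swapped u)) ⟩
      ∏ (λ u → σ (head c (τ u)) ◃ 1) (allFin _)
        ≡⟨ cong (foldr _*_ 1ℤ) (map-∘ (allFin ∣V∣)) ⟩
      ∏ (λ u → σ (head c u) ◃ 1) (map τ (allFin ∣V∣))
        ≡⟨ ∏-↭ _ τ-permutes ⟩
      ∏ (λ u → σ (head c u) ◃ 1) (allFin _) ∎
      where
      τ-permutes : map τ (allFin _) ↭ allFin _
      τ-permutes = unique-sameMembers⇒↭
        (Unique.map⁺ (transpose-injective v w) (Unique.allFin⁺ _)) (Unique.allFin⁺ _)
        (λ {u} _ → ∈-allFin u)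
        (λ {u} _ → subst (_∈ₗ _) (transpose-inverse v w) (∈-map⁺ τ (∈-allFin (transpose w v u))))

    csgn-swap : v ≢ w → csgn swap ≡ - csgn c
    csgn-swap v≢w = begin
      csgn swap ≡⟨ csgn-≡ swap ⟩
      -1ℤ ^ length (cycles (perm swap)) * (T * ∏ (⟦_⟧ swap (head swap)) (allFin _))
        ≡⟨ cong₂ (λ i j → i * (T * j)) flips ∏-head-swap ⟩
      - (-1ℤ ^ length (cycles (perm c))) * (T * H)
        ≡⟨ ℤ.neg-distribˡ-* (-1ℤ ^ length (cycles (perm c))) (T * H) ⟨
      - (-1ℤ ^ length (cycles (perm c)) * (T * H)) ≡⟨ cong -_ (csgn-≡ c) ⟨
      - csgn c ∎
      where
      T H : ℤ
      T = ∏ (⟦_⟧ c (tail c)) (allFin _)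
      H = ∏ (⟦_⟧ c (head c)) (allFin _)
      flips : -1ℤ ^ length (cycles (perm swap)) ≡ - (-1ℤ ^ length (cycles (perm c)))
      flips = CycleCount.-1^cycles-flips v≢w (perm-injective c) (perm-injective swap) swapsAt

  -- The exchange as an involution on a class.

  open Swap using (swap)

  -- An involution on a list must be a function of the contributor alone, whereas `swap` also takes
  -- a proof that the edges agree. Deciding that equality makes it total; the default `c` never
  -- occurs for members of the class, whose chosen steps share an edge.
  swapIfParallel : Contributor G → V → V → Contributor G
  swapIfParallel c v w with edge c v ≟ edge c w
  ... | yes e = swap c v w e
  ... | no  _ = c

  swapIfParallel-≡ : ∀ c v w (e : edge c v ≡ edge c w) → swapIfParallel c v w ≡ swap c v w e
  swapIfParallel-≡ c v w e with edge c v ≟ edge c w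
  ... | yes _ = refl
  ... | no ¬e = contradiction e ¬e

  -- The second exchange names the vertices in reverse order, which is the order that arises in a
  -- head class; `swapIfParallel-comm` covers the unreversed order of a tail class.
  swap-involutive : ∀ c v w (e : edge c v ≡ edge c w) →
                    swapIfParallel (swap c v w e) w v ≡ c
  swap-involutive c v w e = trans (swapIfParallel-≡ (swap c v w e) w v (sym e))
    (contributor-≡ (λ _ → refl) λ u →
      trans (Swap.lookup-swapped (swap c v w e) w v (sym e) u)
        (trans (Swap.lookup-swapped c v w e (transpose w v u))
          (cong (head c) (transpose-inverse v w))))

  swapIfParallel-comm : ∀ c v w → edge c v ≡ edge c w →
                        swapIfParallel c v w ≡ swapIfParallel c w v
  swapIfParallel-comm c v w e = begin
    swapIfParallel c v w ≡⟨ swapIfParallel-≡ c v w e ⟩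
    swap c v w e         ≡⟨ contributor-≡ (λ _ → refl) (λ u →
                              trans (Swap.lookup-swapped c v w e u)
                                (trans (cong (head c) (transpose-comm v w u))
                                  (sym (Swap.lookup-swapped c w v (sym e) u)))) ⟩
    swap c w v (sym e)   ≡⟨ swapIfParallel-≡ c w v (sym e) ⟨
    swapIfParallel c w v ∎

  module _ {N : Pred (Contributor G) ℓ} (N? : Decidable N) (p q : Contributor G → V) where

    -- `p` and `q` select the two steps to exchange. For the exchange to undo itself, the pair
    -- selected afterwards must be the same unordered pair: it stays in order for tail classes and
    -- is reversed for head classes.
    ∑csgn≡0 : (∀ {c} → N c → p c ≢ q c) →
              (∀ {c} → N c → edge c (p c) ≡ edge c (q c)) →
              (∀ {c} → N c → ∀ e → N (swap c (p c) (q c) e)) →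
              (∀ {c} → N c → ∀ e → let d = swap c (p c) (q c) e in
                 (p d ≡ p c × q d ≡ q c) ⊎ (p d ≡ q c × q d ≡ p c)) →
              ∑[ N? ] csgn ≡ 0ℤ
    ∑csgn≡0 p≢q parallel closed stable =
      signReversingInvolution f csgn (Unique.filter⁺ N? contributors-unique)
        (λ {c} c∈ → ∈-filter⁺ N? (∈-contributors (f c))
                  (subst N (sym (f≡swap (in-N c∈))) (closed (in-N c∈) (parallel (in-N c∈)))))
        (λ c∈ → involutive (in-N c∈))
        (λ {c} c∈ → trans (cong csgn (f≡swap (in-N c∈)))
                  (Swap.csgn-swap c (p c) (q c) (parallel (in-N c∈)) (p≢q (in-N c∈))))
      where
      f : Contributor G → Contributor G
      f c = swapIfParallel c (p c) (q c)

      in-N : ∀ {c} → c ∈ₗ filter N? (contributors G) → N c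
      in-N c∈ = proj₂ (∈-filter⁻ N? {xs = contributors G} c∈)

      f≡swap : ∀ {c} (Nc : N c) → f c ≡ swap c (p c) (q c) (parallel Nc)
      f≡swap {c} Nc = swapIfParallel-≡ c (p c) (q c) (parallel Nc)

      involutive : ∀ {c} → N c → f (f c) ≡ c
      involutive {c} Nc = trans (cong f (f≡swap Nc)) (cases (stable Nc (parallel Nc)))
        where
        d : Contributor G
        d = swap c (p c) (q c) (parallel Nc)
        back : swapIfParallel d (q c) (p c) ≡ c
        back = swap-involutive c (p c) (q c) (parallel Nc)
        cases : (p d ≡ p c × q d ≡ q c) ⊎ (p d ≡ q c × q d ≡ p c) → f d ≡ c
        cases (inj₁ (pd , qd)) = trans (cong₂ (swapIfParallel d) pd qd)
          (trans (swapIfParallel-comm d (p c) (q c) (parallel Nc)) back)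
        cases (inj₂ (pd , qd)) = trans (cong₂ (swapIfParallel d) pd qd) back

  -- Tail classes and head classes.

  -- A tail-incidence reveals its vertex as its port, so the set of tails determines the tail at
  -- each vertex.
  tailEquivalent⇒tail-≗ : {c d : Contributor G} → TailEquivalent c d → tail c ≗ tail d
  tailEquivalent⇒tail-≗ {c} {d} eq v
    with w , tdw≡tcv ← ∈-image⁻ (tail d) (subst (tail c v ∈_) eq (∈-image⁺ (tail c) v))
    with refl ← trans (sym (IsContributor.tail-port (isContributor d) w))
                  (trans (cong ς tdw≡tcv) (IsContributor.tail-port (isContributor c) v))
    = sym tdw≡tcv

  -- The head of `c` at `v` is also a head of `d`; its port `perm c v` tells at which vertex, since
  -- `perm d` is injective.
  head-perm⁻¹ : {c d : Contributor G} → HeadEquivalent c d →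
                ∀ v → head d (perm⁻¹ d (perm c v)) ≡ head c v
  head-perm⁻¹ {c} {d} eq v
    with w , hdw≡hcv ← ∈-image⁻ (head d) (subst (head c v ∈_) eq (∈-image⁺ (head c) v))
    = trans (cong (head d) (perm⁻¹-unique d (cong ς hdw≡hcv))) hdw≡hcv

  edge≡ω-head : ∀ (c : Contributor G) v → edge c v ≡ ω (head c v)
  edge≡ω-head c = IsContributor.attachment (isContributor c)

  module _ {N : Pred (Contributor G) ℓ} {c : Contributor G} {v w : V}
           (Nc : N c) (v≢w : v ≢ w) (ev≡ew : edge c v ≡ edge c w) where

    tailClass-∑csgn≡0 : ((c₀ , N⇔) : IsTailClass N) → ∑[ class? (inj₁ (c₀ , N⇔)) ] csgn ≡ 0ℤ
    tailClass-∑csgn≡0 (c₀ , N⇔) = ∑csgn≡0 (class? (inj₁ (c₀ , N⇔))) (λ _ → v) (λ _ → w)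
      (λ _ → v≢w)
      (λ {d} Nd → trans (sym (edges Nd v)) (trans ev≡ew (edges Nd w)))
      -- The exchange leaves the tails unchanged by definition, so the same equality of images
      -- serves again.
      (λ {d} Nd _ → from (N⇔ _) (to (N⇔ d) Nd))
      (λ _ _ → inj₁ (refl , refl))
      where
      open Equivalence
      edges : ∀ {d} → N d → edge c ≗ edge d
      edges {d} Nd u = cong ω (tailEquivalent⇒tail-≗ {c} {d}
        (trans (sym (to (N⇔ c) Nc)) (to (N⇔ d) Nd)) u)

    headClass-∑csgn≡0 : ((c₀ , N⇔) : IsHeadClass N) → ∑[ class? (inj₂ (c₀ , N⇔)) ] csgn ≡ 0ℤ
    headClass-∑csgn≡0 (c₀ , N⇔) = ∑csgn≡0 (class? (inj₂ (c₀ , N⇔))) (at v) (at w)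
      (λ {d} _ eq → v≢w (perm-injective c
        (trans (sym (perm-perm⁻¹ d _)) (trans (cong (perm d) eq) (perm-perm⁻¹ d _)))))
      (λ {d} Nd → trans (edge-at Nd v) (trans ev≡ew (sym (edge-at Nd w))))
      (λ {d} Nd e → from (N⇔ _)
        (trans (to (N⇔ d) Nd) (sym (Swap.image-head-swap d (at v d) (at w d) e))))
      -- After the exchange, the head with port `perm c v` sits at the former `at w d` and vice
      -- versa, so the selected vertices trade places.
      (λ {d} _ e → let open Swap d (at v d) (at w d) e using (perm-swap-v; perm-swap-w) in inj₂
        ( perm⁻¹-unique (swap d _ _ e) (trans perm-swap-w (perm-perm⁻¹ d _))
        , perm⁻¹-unique (swap d _ _ e) (trans perm-swap-v (perm-perm⁻¹ d _))))
      where
      open Equivalence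
      at : V → Contributor G → V
      at u d = perm⁻¹ d (perm c u)
      edge-at : ∀ {d} → N d → ∀ u → edge d (at u d) ≡ edge c u
      edge-at {d} Nd u = begin
        edge d (at u d)     ≡⟨ edge≡ω-head d (at u d) ⟩
        ω (head d (at u d)) ≡⟨ cong ω (head-perm⁻¹ {c} {d}
                                 (trans (sym (to (N⇔ c) Nc)) (to (N⇔ d) Nd)) u) ⟩
        ω (head c u)        ≡⟨ edge≡ω-head c u ⟨
        edge c u            ∎

theorem2p2p3 : ∀ {ℓ} (G : OrientedHypergraph) (N : Pred (Contributor G) ℓ) →
    (class : IsTailClass N ⊎ IsHeadClass N) → NonEdgeMonicClass N →
    ∑[ class? class ] csgn ≡ 0ℤ
-- Being non-edge-monic is a negation and yields no explicit contributor. Equality of integers is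
-- decidable, so it suffices to refute a nonzero sum: under that assumption any two parallel steps
-- in the class are contradictory, making the class edge-monic.
theorem2p2p3 G N class nonMonic = decidable-stable (_ ℤ.≟ 0ℤ) λ ∑≢0 →
  nonMonic λ c Nc v w v≢w ev≡ew → ∑≢0 (vanishes class Nc v≢w ev≡ew)
  where
  vanishes : (class : IsTailClass N ⊎ IsHeadClass N) → ∀ {c v w} → N c → v ≢ w →
             edge c v ≡ edge c w → ∑[ class? class ] csgn ≡ 0ℤ
  vanishes (inj₁ tailClass) Nc v≢w ev≡ew = tailClass-∑csgn≡0 Nc v≢w ev≡ew tailClass
  vanishes (inj₂ headClass) Nc v≢w ev≡ew = headClass-∑csgn≡0 Nc v≢w ev≡ew headClass
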